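{- Let $\epsilon<1$ be a constant. For any instance oracle $f$ with $\max\{|f(G,v)|: G \text{ an } n\text{ -node graph}, v\in G\}=o(n\log n)$ and any deterministic exploration algorithm $A$, for infinitely many $n$ there exist an $n$-node hamiltonian graph $G$ and a starting node $v$ such that the agent executing $A$ with input $f(G,v)$ from $v$ makes at least $n+n^{\epsilon}$ edge traversals before it has visited all nodes and stopped (or fails to explore $G$).
   Context: Model: a graph is a simple connected undirected graph with $n$ nodes. Nodes are unlabeled; at each node of degree $d$ the incident edges carry distinct port numbers $0,\dots,d-1$, arbitrarily assigned. A mobile agent starts at some node. At each step, located at a node $u$ whose degree it knows, it chooses a port at $u$ and traverses the corresponding edge to a neighbor $w$; upon arrival it learns the port number of this edge at $w$ and the degree of $w$. The agent must visit all nodes and stop; the time of exploration is the number of edge traversals. A deterministic exploration algorithm receives as input a binary string (advice); its size is its length. An instance oracle is a function assigning a binary string $f(G,v)$ to each pair $(G,v)$ where $G$ is a port-numbered graph and $v$ is the starting node of the agent. A graph is hamiltonian if it has a cycle through all its nodes. Logarithms are to base 2. -}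

module Defs where

open import Data.Bool.Base using (Bool)
open import Data.Fin.Base using (Fin; toℕ)
open import Data.Integer.Base using (+_; -[1+_])
open import Data.List.Base using (List; length)
open import Data.Nat.Base using (ℕ; suc; _+_; _*_; _∸_; _^_; _≤_; NonZero)
open import Data.Nat.DivMod using (_mod_)
open import Data.Product.Base using (Σ-syntax; ∃; ∃-syntax; _×_; _,_; proj₁; proj₂)
open import Data.Rational.Base as ℚ using (ℚ; 1ℚ; ↥_; ↧ₙ_)
open import Data.Sum.Base using (_⊎_)
open import Function.Bundles using (_⇔_)
open import Function.Definitions using (Injective)
open import Relation.Binary.Construct.Closure.ReflexiveTransitive using (Star)
open import Relation.Binary.PropositionalEquality using (_≡_; _≢_)
open import Relation.Nullary.Negation using (¬_)

------------------------------------------------------------------------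
-- Dedekind reals.

record ℝ : Set₁ where
  field
    lower           : ℚ → Set    -- the rationals q with q < x
    upper           : ℚ → Set    -- the rationals q with x < q
    lower-inhabited : ∃ lower
    upper-inhabited : ∃ upper
    lower-rounded   : ∀ q → lower q ⇔ (∃[ r ] q ℚ.< r × lower r)
    upper-rounded   : ∀ q → upper q ⇔ (∃[ r ] r ℚ.< q × upper r)
    disjoint        : ∀ q → ¬ (lower q × upper q)
    located         : ∀ q r → q ℚ.< r → lower q ⊎ upper r

_<1 : ℝ → Set
x <1 = ℝ.upper x 1ℚ

-- n ^ q ≤ m for n ≥ 1 and q = a / b rational (b > 0): both sides are raised
-- to the power b, and a negative power of n is moved to the right-hand side.
PowerℚAtMost : ℕ → ℚ → ℕ → Set
PowerℚAtMost n q m with ↥ q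
... | + a      = n ^ a ≤ m ^ (↧ₙ q)
... | -[1+ a ] = 1 ≤ m ^ (↧ₙ q) * n ^ suc a

-- n ^ x ≤ m for n ≥ 1 and x real, since n ^ x = sup { n ^ q ∣ q rational, q < x }.
PowerAtMost : ℕ → ℝ → ℕ → Set
PowerAtMost n x m = ∀ q → ℝ.lower x q → PowerℚAtMost n q m

-- t ≥ n + n ^ ε.
AtLeast-n+n^ε : ℕ → ℝ → ℕ → Set
AtLeast-n+n^ε n ε t = n ≤ t × PowerAtMost n ε (t ∸ n)

-- s ≤ n log₂ n, with both sides exponentiated in base 2.
AtMost-nlog₂n : ℕ → ℕ → Set
AtMost-nlog₂n n s = 2 ^ s ≤ n ^ n

------------------------------------------------------------------------
-- Port-numbered graphs.

-- A dart (u , p) is the end at node u of the edge with port p at u; `across`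
-- maps it to the other end of the same edge.
record Graph (n : ℕ) : Set where
  field
    deg : Fin n → ℕ

  Dart : Set
  Dart = Σ[ u ∈ Fin n ] Fin (deg u)

  field
    across : Dart → Dart

  neighbour : (u : Fin n) → Fin (deg u) → Fin n
  neighbour u p = proj₁ (across (u , p))

  entryPort : (u : Fin n) (p : Fin (deg u)) → Fin (deg (neighbour u p))
  entryPort u p = proj₂ (across (u , p))

  Adjacent : Fin n → Fin n → Set
  Adjacent u w = ∃[ p ] neighbour u p ≡ w

  field
    undirected      : ∀ d → across (across d) ≡ d
    noLoops         : ∀ u p → neighbour u p ≢ u
    noMultipleEdges : ∀ u → Injective _≡_ _≡_ (neighbour u)
    connected       : ∀ u w → Star Adjacent u w

cyclicSuc : ∀ {n} → Fin n → Fin n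
cyclicSuc {suc n} i = suc (toℕ i) mod suc n

-- 3 ≤ n because a cycle of a simple graph has at least three nodes.
record Hamiltonian {n : ℕ} (G : Graph n) : Set where
  field
    3≤n       : 3 ≤ n
    cycle     : Fin n → Fin n
    injective : Injective _≡_ _≡_ cycle
    adjacent  : ∀ i → Graph.Adjacent G (cycle i) (cycle (cyclicSuc i))

------------------------------------------------------------------------
-- Oracles, algorithms and their executions.

Advice : Set
Advice = List Bool

InstanceOracle : Set
InstanceOracle = ∀ {n} → Graph n → Fin n → Advice

-- The size of the advice is o(n log n). The bound on the maximum over all
-- (G , v) is a bound for each (G , v), and the constants of the little-o are
-- the numbers 1 / k.
AdviceSize-o[nlogn] : InstanceOracle → Set
AdviceSize-o[nlogn] f =
  ∀ k .{{_ : NonZero k}} → ∃[ N ] ∀ n → N ≤ n →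
    (G : Graph n) (v : Fin n) → AtMost-nlog₂n n (k * length (f G v))

-- Everything the agent has perceived so far, indexed by the degree of its
-- current node.
data History : ℕ → Set where
  start  : (d : ℕ) → History d
  extend : ∀ {d} → History d → (exit : Fin d) →
           (d′ : ℕ) (entry : Fin d′) → History d′

data Action (d : ℕ) : Set where
  stop : Action d
  take : Fin d → Action d

Algorithm : Set
Algorithm = Advice → ∀ {d} → History d → Action d

module Execution (A : Algorithm) (advice : Advice) {n : ℕ} (G : Graph n) (v : Fin n) where
  open Graph G

  -- After t edge traversals from v the agent is at u, having perceived h.
  data Reaches : ℕ → (u : Fin n) → History (deg u) → Set where
    here : Reaches 0 v (start (deg v))
    move : ∀ {t u h p} → Reaches t u h → A advice h ≡ take p →
           Reaches (suc t) (neighbour u p)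
                   (extend h p (deg (neighbour u p)) (entryPort u p))

  StopsAfter : ℕ → Set
  StopsAfter t = ∃[ u ] Σ[ h ∈ History (deg u) ] Reaches t u h × A advice h ≡ stop

  VisitsWithin : ℕ → Fin n → Set
  VisitsWithin t w = ∃[ s ] s ≤ t × (Σ[ h ∈ History (deg w) ] Reaches s w h)

  ExploresInTime : ℕ → Set
  ExploresInTime t = StopsAfter t × (∀ w → VisitsWithin t w)

open Execution public using (ExploresInTime)

{-# OPTIONS --safe #-}

-- Take k sinks and k gadgets, where a gadget is a pair of adjacent ends and every
-- end is adjacent to every sink. Hide the edge of gadget i behind one port
-- h i among the D = k + 1 ports of its ends. An agent that leaves a gadget for
-- the first time by a port other than h i lands in a sink and has to come back,
-- so an exploration in t steps makes at most t + 1 - 3 k wrong first departures.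
-- Given the advice, the run is determined, and h decoded from it, by the values
-- h i at the wrong departures and a bounded number of bits per step. With n = 3 k
-- and k = 16 w, the runs of fewer than n + w steps and the advice strings of size
-- o(n log n) thus account for fewer than D ^ k choices of h, and some h is never
-- decoded. The excess w = n / 48 is at least n ^ ε for large n.

module Submission where

open import Defs
open import Data.Bool.Base using (true; false)
open import Data.Empty using (⊥; ⊥-elim)
open import Data.Fin.Base
  using (Fin; zero; suc; toℕ; fromℕ<; inject₁; opposite; punchIn; punchOut; combine; remQuot;
         finToFun; funToFin)
open import Data.Fin.Properties
  using (_≟_; toℕ-injective; toℕ<n; toℕ-fromℕ<; toℕ-combine; remQuot-combine; combine-remQuot;
         punchInᵢ≢i; punchIn-punchOut; punchOut-punchIn; punchOut-cong; punchOut-injective;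
         opposite-involutive; ¬∀⟶∃¬; injective⇒≤; funToFin-finToFin)
import Data.Integer.Base as ℤ
import Data.Integer.Properties as ℤ
open import Data.List.Base
  using (List; []; _∷_; _∷ʳ_; _++_; map; foldl; length; allFin; cartesianProductWith; lookup)
import Data.List.Membership.DecPropositional as DecMembership
open import Data.List.Membership.Propositional using (_∈_; _∉_)
open import Data.List.Membership.Propositional.Properties
  using (∈-map⁺; ∈-++⁺ˡ; ∈-++⁺ʳ; ∈-allFin; ∈-cartesianProductWith⁺)
open import Data.List.Properties using (foldl-∷ʳ; length-++; length-map; length-tabulate)
open import Data.List.Relation.Unary.Any using (here; there; index)
open import Data.List.Relation.Unary.Any.Properties using (lookup-index)
open import Data.Maybe.Base using (Maybe; just; nothing; fromMaybe)
open import Data.Nat.Base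
open import Data.Nat.DivMod using (_%_; m<n⇒m%n≡m; n%n≡0)
open import Data.Nat.Properties as ℕ hiding (_≟_)
open import Data.Nat.Tactic.RingSolver using (solve-∀)
open import Data.Product.Base using (Σ; Σ-syntax; ∃-syntax; _×_; _,_; proj₁; proj₂; uncurry)
open import Data.Rational.Base as ℚ using (ℚ; mkℚ; 1ℚ; ↧ₙ_)
import Data.Rational.Properties as ℚ
open import Data.Sum.Base using (_⊎_; inj₁; inj₂)
open import Data.Unit.Base using (⊤; tt)
open import Data.Vec.Functional using (Vector; updateAt)
open import Data.Vec.Functional.Properties using (updateAt-updates; updateAt-minimal)
open import Function.Base using (_∘_; const; id)
open import Function.Bundles using (Equivalence)
open import Function.Definitions using (Injective)
open import Relation.Binary.Construct.Closure.ReflexiveTransitive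
  using (Star; _◅_; _◅◅_; gmap) renaming (ε to done)
open import Relation.Binary.Definitions using (tri<; tri≈; tri>)
open import Relation.Binary.PropositionalEquality
open import Relation.Nullary.Decidable.Core using (yes; no)
open import Relation.Nullary.Negation using (contradiction)

open import Algebra.Properties.Monoid.Sum +-0-monoid using (sum; sum-cong-≗)

-- The graphs

-- A graph lives on `Fin n`, while the gadgets are easier to describe on structured nodes. The
-- degree of `u` is by definition that of `node u`, so `pull` keeps ports as they are and only
-- `push` transports them.
module Relabelling {V : Set} {n : ℕ} (label : V → Fin n) (node : Fin n → V)
                   (node-label : ∀ v → node (label v) ≡ v)
                   (label-node : ∀ u → label (node u) ≡ u)
                   (degree : V → ℕ) where

  DartV : Set
  DartV = Σ[ v ∈ V ] Fin (degree v)

  DartF : Set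
  DartF = Σ[ u ∈ Fin n ] Fin (degree (node u))

  push : DartV → DartF
  push (v , p) = label v , subst (Fin ∘ degree) (sym (node-label v)) p

  pull : DartF → DartV
  pull (u , p) = node u , p

  pull-push : ∀ d → pull (push d) ≡ d
  pull-push (v , p) = lemma (node-label v)
    where
    lemma : ∀ {w} (eq : w ≡ v) → (w , subst (Fin ∘ degree) (sym eq) p) ≡ (v , p)
    lemma refl = refl

  push-pull : ∀ d → push (pull d) ≡ d
  push-pull (u , p) = lemma (label-node u) (sym (node-label (node u)))
    where
    lemma : ∀ {w} → w ≡ u → (e : node u ≡ node w) → (w , subst (Fin ∘ degree) e p) ≡ (u , p)
    lemma refl refl = refl

  AdjacentV : (DartV → DartV) → V → V → Set
  AdjacentV cross v w = ∃[ p ] proj₁ (cross (v , p)) ≡ w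

  label-adjacent : ∀ cross v w → AdjacentV cross v w →
                   ∃[ p ] proj₁ (push (cross (pull (label v , p)))) ≡ label w
  label-adjacent cross v w (p , refl) =
    proj₂ (push (v , p)) , cong (proj₁ ∘ push ∘ cross) (pull-push (v , p))

  relabel : (cross : DartV → DartV) →
            (∀ d → cross (cross d) ≡ d) →
            (∀ v p → proj₁ (cross (v , p)) ≢ v) →
            (∀ v → Injective _≡_ _≡_ (λ p → proj₁ (cross (v , p)))) →
            (∀ v w → Star (AdjacentV cross) v w) →
            Graph n
  relabel cross involutive loopless simple reachable = record
    { deg             = degree ∘ node
    ; across          = push ∘ cross ∘ pull
    ; undirected      = λ d → trans (cong (push ∘ cross) (pull-push (cross (pull d))))
                                    (trans (cong push (involutive (pull d))) (push-pull d))
    ; noLoops         = λ u p eq → loopless (node u) p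
                          (trans (sym (node-label _)) (cong node eq))
    ; noMultipleEdges = λ u eq → simple (node u)
                          (trans (sym (node-label _)) (trans (cong node eq) (node-label _)))
    ; connected       = λ u w → subst₂ (Star _) (label-node u) (label-node w)
                          (gmap label (λ {v} {w} → label-adjacent cross v w)
                             (reachable (node u) (node w)))
    }

  -- The degree of `node (label v)` equals that of `v` only propositionally. An equation between
  -- pairs of node and history spares a transport of the history.
  extend-push : ∀ {d} (g : History d) (p : Fin d) ((v , q) : DartV) →
                let u , q′ = push (v , q) in
                _≡_ {A = Σ V (History ∘ degree)}
                    (node u , extend g p (degree (node u)) q′) (v , extend g p (degree v) q)
  extend-push g p d = cong (λ (v , q) → v , extend g p (degree v) q) (pull-push d)

cyclicSuc-step : ∀ {n} (x y : Fin n) → suc (toℕ x) ≡ toℕ y → cyclicSuc x ≡ y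
cyclicSuc-step {suc n} x y eq = toℕ-injective (begin
  toℕ (cyclicSuc x)     ≡⟨ toℕ-fromℕ< _ ⟩
  suc (toℕ x) % suc n   ≡⟨ cong (_% suc n) eq ⟩
  toℕ y % suc n         ≡⟨ m<n⇒m%n≡m (toℕ<n y) ⟩
  toℕ y                 ∎)
  where open ≡-Reasoning

cyclicSuc-wrap : ∀ {n} (x : Fin (suc n)) → suc (toℕ x) ≡ suc n → cyclicSuc x ≡ zero
cyclicSuc-wrap {n} x eq = toℕ-injective (begin
  toℕ (cyclicSuc x)     ≡⟨ toℕ-fromℕ< _ ⟩
  suc (toℕ x) % suc n   ≡⟨ cong (_% suc n) eq ⟩
  suc n % suc n         ≡⟨ n%n≡0 (suc n) ⟩
  0                     ∎)
  where open ≡-Reasoning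

opposite≢ : (b : Fin 2) → opposite b ≢ b
opposite≢ zero ()
opposite≢ (suc zero) ()

-- The graph has k sinks and k gadgets. Gadget i has two ends, joined by an edge
-- with port h i at both of them; the other k ports of an end lead to the k
-- sinks. A node is encoded by its gadget or sink number and its kind.
pattern sink j = j , zero
pattern end i b = i , suc b

module GadgetGraph (k′ : ℕ) where

  k D : ℕ
  k = suc k′
  D = suc k

  Node : Set
  Node = Fin k × Fin 3

  degree : Node → ℕ
  degree (sink j)  = k * 2
  degree (end i b) = D

  label : Node → Fin (k * 3)
  label = uncurry combine

  node : Fin (k * 3) → Node
  node = remQuot {k} 3

  node-label : ∀ v → node (label v) ≡ v
  node-label = uncurry remQuot-combine

  label-node : ∀ u → label (node u) ≡ u
  label-node = combine-remQuot {k} 3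

  open Relabelling label node node-label label-node degree public

  -- The hidden port `d` is an argument and not read off `h`, because the simulation calls the same
  -- function with its guess of that port.
  crossEnd : Fin D → Fin k → Fin 2 → Fin D → DartV
  crossEnd d i b p with d ≟ p
  ... | yes _  = end i (opposite b) , p
  ... | no d≢p = sink (punchOut d≢p) , combine i b

  crossEnd-hit : ∀ d i b → crossEnd d i b d ≡ (end i (opposite b) , d)
  crossEnd-hit d i b with d ≟ d
  ... | yes _  = refl
  ... | no d≢d = contradiction refl d≢d

  crossEnd-miss : ∀ {d p} i b (d≢p : d ≢ p) →
                  crossEnd d i b p ≡ (sink (punchOut d≢p) , combine i b)
  crossEnd-miss {d} {p} i b d≢p with d ≟ p
  ... | yes d≡p = contradiction d≡p d≢p
  ... | no _    = cong (λ j → sink j , combine i b) (punchOut-cong d refl)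

  module Hidden (h : Fin k → Fin D) where

    -- Sink `j` lies behind the `j`-th port other than `h i`. An arrival from it thus reveals only
    -- on which side of `h i` that port lies.
    cross : DartV → DartV
    cross (sink j  , q) = let i , b = remQuot {k} 2 q in end i b , punchIn (h i) j
    cross (end i b , p) = crossEnd (h i) i b p

    cross-sink : ∀ i b j → cross (sink j , combine i b) ≡ (end i b , punchIn (h i) j)
    cross-sink i b j =
      cong {A = Fin k × Fin 2} (λ (i , b) → end i b , punchIn (h i) j) (remQuot-combine {k} i b)

    involutive : ∀ d → cross (cross d) ≡ d
    involutive (sink j , q) = trans (crossEnd-miss i b (punchInᵢ≢i (h i) j ∘ sym))
      (cong₂ (λ x y → sink x , y) (punchOut-punchIn (h i)) (combine-remQuot {k} 2 q))
      where
      i = proj₁ (remQuot {k} 2 q)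
      b = proj₂ (remQuot {k} 2 q)
    involutive (end i b , p) with h i ≟ p
    ... | yes refl = trans (crossEnd-hit (h i) i (opposite b))
                           (cong (λ c → end i c , p) (opposite-involutive b))
    ... | no h≢p   = trans (cross-sink i b (punchOut h≢p))
                           (cong (end i b ,_) (punchIn-punchOut h≢p))

    loopless : ∀ v p → proj₁ (cross (v , p)) ≢ v
    loopless (sink j)  p ()
    loopless (end i b) p eq with h i ≟ p
    loopless (end i zero) p () | yes _
    loopless (end i (suc zero)) p () | yes _
    loopless (end i b) p () | no _

    simple : ∀ v → Injective _≡_ _≡_ (λ p → proj₁ (cross (v , p)))
    simple (sink j) {p} {q} eq = begin
      p                                    ≡⟨ combine-remQuot {k} 2 p ⟨
      uncurry combine (remQuot {k} 2 p)
        ≡⟨ cong (uncurry combine) (end-injective (remQuot {k} 2 p) (remQuot {k} 2 q) eq) ⟩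
      uncurry combine (remQuot {k} 2 q)    ≡⟨ combine-remQuot {k} 2 q ⟩
      q                                    ∎
      where
      open ≡-Reasoning
      end-injective : ∀ x y → _≡_ {A = Node} (end (proj₁ x) (proj₂ x)) (end (proj₁ y) (proj₂ y)) →
                      x ≡ y
      end-injective x y refl = refl
    simple (end i b) {p} {q} eq with h i ≟ p | h i ≟ q
    ... | yes refl | yes refl = refl
    ... | no h≢p   | no h≢q   = punchOut-injective h≢p h≢q (cong proj₁ eq)
    simple (end i b) {p} {q} () | yes _ | no _
    simple (end i b) {p} {q} () | no _ | yes _

    sink-end : ∀ j i b → AdjacentV cross (sink j) (end i b)
    sink-end j i b = combine i b , cong proj₁ (cross-sink i b j)

    end-sink : ∀ i b j → AdjacentV cross (end i b) (sink j)
    end-sink i b j = punchIn (h i) j ,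
      cong proj₁ (trans (cong cross (sym (cross-sink i b j))) (involutive (sink j , combine i b)))

    end-end : ∀ i b → AdjacentV cross (end i b) (end i (opposite b))
    end-end i b = h i , cong proj₁ (crossEnd-hit (h i) i b)

    reachable : ∀ v w → Star (AdjacentV cross) v w
    reachable v w = to-origin v ◅◅ from-origin w
      where
      to-origin : ∀ v → Star (AdjacentV cross) v (sink zero)
      to-origin (sink j)  = sink-end j zero zero ◅ end-sink zero zero zero ◅ done
      to-origin (end i b) = end-sink i b zero ◅ done
      from-origin : ∀ w → Star (AdjacentV cross) (sink zero) w
      from-origin (sink j)  = sink-end zero zero zero ◅ end-sink zero zero j ◅ done
      from-origin (end i b) = sink-end zero i b ◅ done

    graph : Graph (k * 3)
    graph = relabel cross involutive loopless simple reachable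

    adjacent-cyclicSuc : ∀ v w → AdjacentV cross v w → cyclicSuc (label v) ≡ label w →
                         Graph.Adjacent graph (label v) (cyclicSuc (label v))
    adjacent-cyclicSuc v w v~w eq =
      subst (Graph.Adjacent graph (label v)) (sym eq) (label-adjacent cross v w v~w)

    after-last : ∀ i → suc (toℕ (label (end i (suc zero)))) ≡ 3 * suc (toℕ i)
    after-last i = begin
      suc (toℕ (label (end i (suc zero)))) ≡⟨ cong suc (toℕ-combine {n = 3} i (suc (suc zero))) ⟩
      suc (3 * toℕ i + 2)                  ≡⟨ +-suc (3 * toℕ i) 2 ⟨
      3 * toℕ i + 3                        ≡⟨ +-comm (3 * toℕ i) 3 ⟩
      3 + 3 * toℕ i                        ≡⟨ *-suc 3 (toℕ i) ⟨
      3 * suc (toℕ i)                      ∎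
      where open ≡-Reasoning

    -- The order of the labels is itself a hamiltonian cycle: sink `j`, the two ends of gadget `j`,
    -- the next sink, and so on, with a wrap to sink `zero`. It uses hidden edges and edges between
    -- ends and sinks, which exist for every `h`.
    successor : ∀ v → Graph.Adjacent graph (label v) (cyclicSuc (label v))
    successor (sink j) = adjacent-cyclicSuc (sink j) (end j zero) (sink-end j j zero)
      (cyclicSuc-step (label (sink j)) (label (end j zero)) (begin
        suc (toℕ (combine j zero))   ≡⟨ cong suc (toℕ-combine j zero) ⟩
        suc (3 * toℕ j + 0)          ≡⟨ +-suc (3 * toℕ j) 0 ⟨
        3 * toℕ j + 1                ≡⟨ toℕ-combine {n = 3} j (suc zero) ⟨
        toℕ (label (end j zero))     ∎))
      where open ≡-Reasoning
    successor (end i zero) = adjacent-cyclicSuc (end i zero) (end i (suc zero)) (end-end i zero)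
      (cyclicSuc-step (label (end i zero)) (label (end i (suc zero))) (begin
        suc (toℕ (label (end i zero)))  ≡⟨ cong suc (toℕ-combine {n = 3} i (suc zero)) ⟩
        suc (3 * toℕ i + 1)             ≡⟨ +-suc (3 * toℕ i) 1 ⟨
        3 * toℕ i + 2                   ≡⟨ toℕ-combine {n = 3} i (suc (suc zero)) ⟨
        toℕ (label (end i (suc zero)))  ∎))
      where open ≡-Reasoning
    successor (end i (suc zero)) with suc (toℕ i) ℕ.≟ k
    ... | yes i+1≡k = adjacent-cyclicSuc (end i (suc zero)) (sink zero) (end-sink i (suc zero) zero)
      (cyclicSuc-wrap (label (end i (suc zero))) (begin
        suc (toℕ (label (end i (suc zero)))) ≡⟨ after-last i ⟩
        3 * suc (toℕ i)                      ≡⟨ cong (3 *_) i+1≡k ⟩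
        3 * k                                ≡⟨ *-comm 3 k ⟩
        k * 3                                ∎))
      where open ≡-Reasoning
    ... | no i+1≢k = adjacent-cyclicSuc (end i (suc zero)) (sink j) (end-sink i (suc zero) j)
      (cyclicSuc-step (label (end i (suc zero))) (label (sink j)) (begin
        suc (toℕ (label (end i (suc zero)))) ≡⟨ after-last i ⟩
        3 * suc (toℕ i)                      ≡⟨ cong (3 *_) (toℕ-fromℕ< i+1<k) ⟨
        3 * toℕ j                            ≡⟨ +-identityʳ _ ⟨
        3 * toℕ j + 0                        ≡⟨ toℕ-combine {n = 3} j zero ⟨
        toℕ (label (sink j))                 ∎))
      where
      open ≡-Reasoning
      i+1<k = ≤∧≢⇒< (toℕ<n i) i+1≢k
      j = fromℕ< i+1<k

    hamiltonian : Hamiltonian graph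
    hamiltonian = record
      { 3≤n       = s≤s (s≤s (s≤s z≤n))
      ; cycle     = λ u → u
      ; injective = λ eq → eq
      ; adjacent  = λ u → subst (λ x → Graph.Adjacent graph x (cyclicSuc x)) (label-node u)
                            (successor (node u))
      }

-- Simulation and its cost

updateAt-elim : ∀ {A : Set} {n} (P : Fin n → A → Set) {i : Fin n} {f : A → A} (xs : Vector A n) →
                P i (f (xs i)) → (∀ j → j ≢ i → P j (xs j)) → ∀ j → P j (updateAt xs i f j)
updateAt-elim P {i} xs updated others j with j ≟ i
... | yes refl = subst (P j) (sym (updateAt-updates j xs)) updated
... | no j≢i   = subst (P j) (sym (updateAt-minimal j i xs j≢i)) (others j j≢i)

sum-updateAt : ∀ {A : Set} {n} (w : A → ℕ) (i : Fin n) {f : A → A} (xs : Vector A n) →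
               sum (w ∘ updateAt xs i f) + w (xs i) ≡ sum (w ∘ xs) + w (f (xs i))
sum-updateAt w zero    xs = swap-ends (w _) _ (w (xs zero))
  where
  swap-ends : ∀ a b c → a + b + c ≡ c + b + a
  swap-ends = solve-∀
sum-updateAt w (suc i) {f} xs = begin
  w₀ + sum (w ∘ updateAt xs′ i f) + w (xs′ i)    ≡⟨ +-assoc w₀ _ _ ⟩
  w₀ + (sum (w ∘ updateAt xs′ i f) + w (xs′ i))  ≡⟨ cong (w₀ +_) (sum-updateAt w i xs′) ⟩
  w₀ + (sum (w ∘ xs′) + w (f (xs′ i)))           ≡⟨ +-assoc w₀ _ _ ⟨
  w₀ + sum (w ∘ xs′) + w (f (xs′ i))             ∎
  where
  open ≡-Reasoning
  w₀ = w (xs zero)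
  xs′ = xs ∘ suc

sum-const : ∀ n c → sum {n} (const c) ≡ n * c
sum-const zero    c = refl
sum-const (suc n) c = cong (c +_) (sum-const n c)

-- One bit per departure from a sink therefore suffices: `plain` selects `inject₁ j` and `shifted`
-- selects `suc j`.
punchIn-cases : ∀ {n} (i : Fin (suc n)) j → punchIn i j ≡ inject₁ j ⊎ punchIn i j ≡ suc j
punchIn-cases zero    j       = inj₂ refl
punchIn-cases (suc i) zero    = inj₁ refl
punchIn-cases (suc i) (suc j) with punchIn-cases i j
... | inj₁ eq = inj₁ (cong suc eq)
... | inj₂ eq = inj₂ (cong suc eq)

-- The answers missing from a simulation of the agent without knowledge of h:
-- on leaving a sink, which of the two possible ports the agent arrives at; on the
-- first departure from a gadget, whether the port is h i (plain) or else the
-- value of h i (correction).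
data Hint (D : ℕ) : Set where
  plain shifted : Hint D
  correction    : Fin D → Hint D

surcharge : ∀ {D} → Hint D → ℕ
surcharge (correction _) = 1
surcharge _              = 0

corrections : ∀ {D} → List (Hint D) → ℕ
corrections []       = 0
corrections (s ∷ ss) = surcharge s + corrections ss

corrections-∷ʳ : ∀ {D} (ss : List (Hint D)) s → corrections (ss ∷ʳ s) ≡ corrections ss + surcharge s
corrections-∷ʳ []       s = +-identityʳ (surcharge s)
corrections-∷ʳ (x ∷ ss) s =
  trans (cong (surcharge x +_) (corrections-∷ʳ ss s)) (sym (+-assoc (surcharge x) _ _))

-- failed b: the first departure, from end b, went to a sink and the other end
-- has not been visited since; mended: it has.
data Status : Set where
  fresh          : Status
  entered failed : Fin 2 → Status
  passed mended  : Status

-- The hidden port becomes known at the first departure from the gadget, not on entry.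
known : ∀ {D} → Status → Fin D → Maybe (Fin D)
known fresh       d = nothing
known (entered _) d = nothing
known _           d = just d

Visited : Status → Fin 2 → Set
Visited fresh       b = ⊥
Visited (entered c) b = c ≡ b
Visited (failed c)  b = c ≡ b
Visited passed      b = ⊤
Visited mended      b = ⊤

-- weight counts the visited ends of a gadget and the sink visited before the
-- first of them. A failed gadget needs a second such sink, so a correction can be
-- charged 1: it is taken from the weight of the gadget and restored when the other
-- end is reached. slack is the time spent on an entry that has not yet done so.
weight slack : Status → ℕ
weight fresh       = 0
weight (entered _) = 2
weight (failed _)  = 1
weight passed      = 3
weight mended      = 3
slack (failed _)   = 1
slack _            = 0

enter : Fin 2 → Status → Status
enter b fresh = entered b
enter b (failed c) with c ≟ b
... | yes _ = failed c
... | no _  = mended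
enter b s = s

pass miss : Status → Status
pass (entered _) = passed
pass (failed _)  = mended
pass s           = s
miss (entered b) = failed b
miss s           = s

missHint : ∀ {D} → Status → Fin D → Hint D
missHint (entered _) d = correction d
missHint _           d = plain

-- Effect of one traversal on the status of a gadget

enter-entered : ∀ b s c → (∀ e → s ≢ entered e) → enter b s ≡ entered c → b ≡ c
enter-entered b fresh       c ¬e refl = refl
enter-entered b (entered e) c ¬e eq = contradiction refl (¬e e)
enter-entered b (failed e)  c ¬e eq with e ≟ b
enter-entered b (failed e)  c ¬e () | yes _
enter-entered b (failed e)  c ¬e () | no _

enter-visited : ∀ b s → (∀ e → s ≢ entered e) → Visited (enter b s) b
enter-visited b fresh       ¬e = refl
enter-visited b (entered e) ¬e = contradiction refl (¬e e)
enter-visited b (failed c)  ¬e with c ≟ b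
... | yes c≡b = c≡b
... | no _    = tt
enter-visited b passed      ¬e = tt
enter-visited b mended      ¬e = tt

enter-mono : ∀ b s c → Visited s c → Visited (enter b s) c
enter-mono b (entered e) c v = v
enter-mono b (failed e)  c v with e ≟ b
... | yes _ = v
... | no _  = tt
enter-mono b passed      c v = tt
enter-mono b mended      c v = tt

enter-known : ∀ {D} b s (d : Fin D) → known (enter b s) d ≡ known s d
enter-known b fresh       d = refl
enter-known b (entered e) d = refl
enter-known b (failed e)  d with e ≟ b
... | yes _ = refl
... | no _  = refl
enter-known b passed      d = refl
enter-known b mended      d = refl

-- On the right, the two units are the slack of the sink being left and the time of the step. Both
-- are spent when a fresh gadget is entered or a failed one is mended.
enter-cost : ∀ b s → (∀ e → s ≢ entered e) →
             weight (enter b s) + 0 + slack (enter b s) ≤ weight s + 1 + 1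
enter-cost b fresh       ¬e = ≤-refl
enter-cost b (entered e) ¬e = contradiction refl (¬e e)
enter-cost b (failed c)  ¬e with c ≟ b
... | yes _ = m≤m+n 2 1
... | no _  = ≤-refl
enter-cost b passed      ¬e = m≤m+n 3 2
enter-cost b mended      ¬e = m≤m+n 3 2

pass-visited : ∀ s b c → Visited s b → Visited (pass s) c
pass-visited (entered _) b c v = tt
pass-visited (failed _)  b c v = tt
pass-visited passed      b c v = tt
pass-visited mended      b c v = tt

pass-known : ∀ {D} s b (d : Fin D) → Visited s b → known (pass s) d ≡ just d
pass-known (entered _) b d v = refl
pass-known (failed _)  b d v = refl
pass-known passed      b d v = refl
pass-known mended      b d v = refl

pass-pending : ∀ s c → pass s ≢ entered c
pass-pending fresh       c ()
pass-pending (entered _) c ()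
pass-pending (failed _)  c ()

pass-cost : ∀ s b → Visited s b →
            weight (pass s) + 0 + slack (pass s) ≤ weight s + slack s + 1
pass-cost (entered _) b v = ≤-refl
pass-cost (failed _)  b v = ≤-refl
pass-cost passed      b v = m≤m+n 3 1
pass-cost mended      b v = m≤m+n 3 1

miss-mono : ∀ s c → Visited s c → Visited (miss s) c
miss-mono (entered e) c v = v
miss-mono (failed e)  c v = v
miss-mono passed      c v = tt
miss-mono mended      c v = tt

miss-known : ∀ {D} s b (d : Fin D) → Visited s b → known (miss s) d ≡ just d
miss-known (entered _) b d v = refl
miss-known (failed _)  b d v = refl
miss-known passed      b d v = refl
miss-known mended      b d v = refl

miss-pending : ∀ s c → miss s ≢ entered c
miss-pending fresh       c ()
miss-pending (entered _) c ()
miss-pending (failed _)  c ()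

-- The 1 on the left is the slack of the sink where the agent lands. On a first departure the weight
-- drops from 2 to 1, which pays for the correction.
miss-cost : ∀ {D} s b (d : Fin D) → Visited s b →
            weight (miss s) + surcharge (missHint s d) + 1 ≤ weight s + slack s + 1
miss-cost (entered _) b d v = ≤-refl
miss-cost (failed _)  b d v = m≤m+n 2 1
miss-cost passed      b d v = ≤-refl
miss-cost mended      b d v = ≤-refl

guess : ∀ {D} → Maybe (Fin D) → Fin D → Hint D → Fin D
guess (just d) p s              = d
guess nothing  p (correction d) = d
guess nothing  p _              = p

guess-hit : ∀ {D} s (d : Fin D) → guess (known s d) d plain ≡ d
guess-hit fresh       d = refl
guess-hit (entered _) d = refl
guess-hit (failed _)  d = refl
guess-hit passed      d = refl
guess-hit mended      d = refl

guess-miss : ∀ {D} s b (d p : Fin D) → Visited s b → guess (known s d) p (missHint s d) ≡ d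
guess-miss (entered _) b d p v = refl
guess-miss (failed _)  b d p v = refl
guess-miss passed      b d p v = refl
guess-miss mended      b d p v = refl

-- The statuses `entered` and `failed` remember exactly one visited end, so only the two final
-- statuses remain.
both-visited : ∀ s → Visited s zero → Visited s (suc zero) →
               (∀ {D} (d : Fin D) → known s d ≡ just d) × weight s ≡ 3
both-visited (entered _) refl ()
both-visited (failed _)  refl ()
both-visited passed      _ _  = (λ _ → refl) , refl
both-visited mended      _ _  = (λ _ → refl) , refl

-- Here `S` and `S′` are the total weights before and after a step, `x` and `x′` the weights of the
-- gadget that changes, `δ` the surcharge of the new hint, `l` and `l′` the slacks, and `c` the
-- corrections so far. Adding `x` on both sides leaves only the local inequality to check.
cost-step : ∀ S S′ x x′ δ l l′ c t → S′ + x ≡ S + x′ → x′ + δ + l′ ≤ x + l + 1 →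
            S + c + l ≤ suc t → S′ + (c + δ) + l′ ≤ suc (suc t)
cost-step S S′ x x′ δ l l′ c t sums local bound = +-cancelʳ-≤ x _ _ (begin
  S′ + (c + δ) + l′ + x     ≡⟨ shuffle₁ S′ c δ l′ x ⟩
  (S′ + x) + c + (δ + l′)   ≡⟨ cong (λ y → y + c + (δ + l′)) sums ⟩
  (S + x′) + c + (δ + l′)   ≡⟨ shuffle₂ S x′ c δ l′ ⟩
  (S + c) + (x′ + δ + l′)   ≤⟨ +-monoʳ-≤ (S + c) local ⟩
  (S + c) + (x + l + 1)     ≡⟨ shuffle₃ S c x l ⟩
  suc (S + c + l) + x       ≤⟨ +-monoˡ-≤ x (s≤s bound) ⟩
  suc (suc t) + x           ∎)
  where
  open ≤-Reasoning
  shuffle₁ : ∀ a b c d e → a + (b + c) + d + e ≡ (a + e) + b + (c + d)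
  shuffle₁ = solve-∀
  shuffle₂ : ∀ a b c d e → (a + b) + c + (d + e) ≡ (a + c) + (b + d + e)
  shuffle₂ = solve-∀
  shuffle₃ : ∀ a b c d → (a + b) + (c + d + 1) ≡ suc (a + b + d) + c
  shuffle₃ = solve-∀

-- Replaying a run from its hints

module Simulation (A : Algorithm) (advice : Advice) (k′ : ℕ) where

  open GadgetGraph k′

  Knowledge : Set
  Knowledge = Vector (Maybe (Fin D)) k

  Position : Set
  Position = Σ[ v ∈ Node ] History (degree v)

  move : Knowledge → (v : Node) → Fin (degree v) → Hint D → DartV × Knowledge
  move K (sink j) q s = (let i , b = remQuot {k} 2 q in end i b , entry s) , K
    where
    entry : Hint D → Fin D
    entry plain = inject₁ j
    entry _     = suc j
  move K (end i b) p s = crossEnd d i b p , updateAt K i (const (just d))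
    -- Once the port is known, `guess` returns it again, so later departures record the same value.
    where d = guess (K i) p s

  -- The action is a separate argument so that an equation for `A advice g` can be applied by
  -- congruence.
  follow : Knowledge → ∀ v → History (degree v) → Action (degree v) → Hint D → Position × Knowledge
  follow K v g stop     s = (v , g) , K
  follow K v g (take p) s =
    let (v′ , q) , K′ = move K v p s in (v′ , extend g p (degree v′) q) , K′

  step : Position × Knowledge → Hint D → Position × Knowledge
  step ((v , g) , K) s = follow K v g (A advice g) s

  simulate : List (Hint D) → Position × Knowledge
  simulate = foldl step ((sink zero , start (degree (sink zero))) , const nothing)

  decode : List (Hint D) → Fin k → Fin D
  -- The default `zero` does not occur for the hints of a full exploration, since all ports are
  -- known at its end.
  decode ss i = fromMaybe zero (proj₂ (simulate ss) i)

  simulate-∷ʳ : ∀ {ss v g K p} s → simulate ss ≡ ((v , g) , K) → A advice g ≡ take p →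
                simulate (ss ∷ʳ s) ≡ follow K v g (take p) s
  simulate-∷ʳ {ss} {v} {g} {K} s eq act =
    trans (foldl-∷ʳ step _ s ss)
          (trans (cong (λ x → step x s) eq) (cong (λ a → follow K v g a s) act))

  module Correct (h : Fin k → Fin D) where

    open Hidden h

    VisitedNode : (Fin k → Status) → Node → Set
    VisitedNode st (sink j)  = ⊤
    VisitedNode st (end i b) = Visited (st i) b

    slackAt : (Fin k → Status) → Node → ℕ
    slackAt st (sink j)  = 1
    slackAt st (end i b) = slack (st i)

    -- The invariant of the run. By `pending`, a gadget whose first departure is outstanding is the
    -- one where the agent stands. In `cost` the bound is `suc t` because the starting sink already
    -- has slack 1 at time 0.
    record Replay (t : ℕ) (v : Node) (g : History (degree v)) : Set where
      field
        hints     : List (Hint D)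
        knowledge : Knowledge
        status    : Fin k → Status
        simulated : simulate hints ≡ ((v , g) , knowledge)
        duration  : length hints ≡ t
        agrees    : ∀ i → knowledge i ≡ known (status i) (h i)
        visited   : VisitedNode status v
        pending   : ∀ i b → status i ≡ entered b → v ≡ end i b
        cost      : sum (weight ∘ status) + corrections hints + slackAt status v ≤ suc t

    open Replay

    initial : Replay 0 (sink zero) (start (degree (sink zero)))
    initial = record
      { hints     = []
      ; knowledge = const nothing
      ; status    = const fresh
      ; simulated = refl
      ; duration  = refl
      ; agrees    = λ i → refl
      ; visited   = tt
      ; pending   = λ i b ()
      ; cost      = ≤-reflexive (cong (λ n → n + 0 + 1) (trans (sum-const k 0) (*-zeroʳ k)))
      }

    Extends : ∀ {t v g} → Replay t v g → ∀ {t′ v′ g′} → Replay t′ v′ g′ → Set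
    Extends R R′ = ∀ w → VisitedNode (status R) w → VisitedNode (status R′) w

    Successor : ∀ {t v} {g : History (degree v)} → Replay t v g → Fin (degree v) → DartV → Set
    Successor {t} {v} {g} R p (v′ , q) =
      Σ[ R′ ∈ Replay (suc t) v′ (extend g p (degree v′) q) ] Extends R R′

    module _ {t v} {g : History (degree v)} (R : Replay t v g) {p : Fin (degree v)}
             (act : A advice g ≡ take p) where

      -- A traversal alters the status of a single gadget `i`, so apart from the simulated move the
      -- invariant reduces to facts about `i` and the new position.
      successor-by : ∀ {v′ q} s i (f : Status → Status) K →
        move (knowledge R) v p s ≡ ((v′ , q) , K) →
        (∀ j → K j ≡ known (updateAt (status R) i f j) (h j)) →
        VisitedNode (updateAt (status R) i f) v′ →
        (∀ j b → updateAt (status R) i f j ≡ entered b → v′ ≡ end j b) →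
        (∀ b → Visited (status R i) b → Visited (f (status R i)) b) →
        weight (f (status R i)) + surcharge s + slackAt (updateAt (status R) i f) v′
          ≤ weight (status R i) + slackAt (status R) v + 1 →
        Successor R p (v′ , q)
      successor-by {v′} {q} s i f K moved agrees′ visited′ pending′ mono local = record
        { hints     = hints R ∷ʳ s
        ; knowledge = K
        ; status    = updateAt (status R) i f
        ; simulated = trans (simulate-∷ʳ {ss = hints R} s (simulated R) act)
            (cong (λ ((v′ , q) , K) → (v′ , extend g p (degree v′) q) , K) moved)
        ; duration  = trans (length-++ (hints R)) (trans (+-comm _ 1) (cong suc (duration R)))
        ; agrees    = agrees′
        ; visited   = visited′
        ; pending   = pending′
        ; cost      = subst
            (λ c → sum (weight ∘ updateAt (status R) i f) + c + slackAt (updateAt (status R) i f) v′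
                     ≤ suc (suc t))
            (sym (corrections-∷ʳ (hints R) s))
            (cost-step _ _ (weight (status R i)) (weight (f (status R i))) (surcharge s)
               (slackAt (status R) v) (slackAt (updateAt (status R) i f) v′)
               (corrections (hints R)) t
               (sum-updateAt weight i (status R)) local (cost R))
        } , extends
        where
        extends : ∀ w → VisitedNode (status R) w → VisitedNode (updateAt (status R) i f) w
        extends (sink j)  _ = tt
        extends (end j b) = updateAt-elim (λ j s → Visited (status R j) b → Visited s b) (status R)
                              (mono b) (λ _ _ x → x) j

    module _ {t j} {g : History (degree (sink j))} (R : Replay t (sink j) g)
             {q : Fin (degree (sink j))} (act : A advice g ≡ take q) where

      private
        i = proj₁ (remQuot {k} 2 q)
        b = proj₂ (remQuot {k} 2 q)
        st = status R

        -- By `pending`, an `entered` gadget would place the agent at one of its ends, but it stands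
        -- at a sink.
        no-pending : ∀ i e → st i ≢ entered e
        no-pending i e eq with () ← pending R i e eq

        enter-by : ∀ s → move (knowledge R) (sink j) q s ≡ (cross (sink j , q) , knowledge R) →
                   surcharge s ≡ 0 → Successor R q (cross (sink j , q))
        enter-by s moved free = successor-by R act s i (enter b) (knowledge R) moved
          (updateAt-elim (λ j s → knowledge R j ≡ known s (h j)) st
             (trans (agrees R i) (sym (enter-known b (st i) (h i)))) (λ j _ → agrees R j))
          (subst (λ s → Visited s b) (sym (updateAt-updates i st))
             (enter-visited b (st i) (no-pending i)))
          (updateAt-elim (λ j s → ∀ c → s ≡ entered c → end i b ≡ end j c) st
             (λ c eq → cong (λ c → end i c) (enter-entered b (st i) c (no-pending i) eq))
             (λ j _ c eq → ⊥-elim (no-pending j c eq)))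
          (enter-mono b (st i))
          (subst₂ (λ n s → weight (enter b (st i)) + n + slack s ≤ weight (st i) + 1 + 1)
             (sym free) (sym (updateAt-updates i st)) (enter-cost b (st i) (no-pending i)))

      leave-sink : Successor R q (cross (sink j , q))
      leave-sink with punchIn-cases (h i) j
      ... | inj₁ eq = enter-by plain   (cong (λ d → (end i b , d) , knowledge R) (sym eq)) refl
      ... | inj₂ eq = enter-by shifted (cong (λ d → (end i b , d) , knowledge R) (sym eq)) refl

    module _ {t i b} {g : History D} (R : Replay t (end i b) g)
             {p : Fin D} (act : A advice g ≡ take p) where

      private
        st = status R

        leave-by : ∀ {v′ q} s f → guess (knowledge R i) p s ≡ h i →
          crossEnd (h i) i b p ≡ (v′ , q) →
          known (f (st i)) (h i) ≡ just (h i) →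
          VisitedNode (updateAt st i f) v′ →
          (∀ c → f (st i) ≢ entered c) →
          (∀ c → Visited (st i) c → Visited (f (st i)) c) →
          weight (f (st i)) + surcharge s + slackAt (updateAt st i f) v′
            ≤ weight (st i) + slack (st i) + 1 →
          Successor R p (v′ , q)
        leave-by s f guessed crossed learnt visited′ settled mono local =
          successor-by R act s i f (updateAt (knowledge R) i (const (just (h i))))
            (trans (cong (λ d → crossEnd d i b p , updateAt (knowledge R) i (const (just d)))
                         guessed)
                   (cong (_, _) crossed))
            agrees′ visited′
            (updateAt-elim (λ j s → ∀ c → s ≡ entered c → _ ≡ end j c) st
              (λ c eq → ⊥-elim (settled c eq))
              -- The agent stands in gadget `i`, so no other gadget can be `entered`.
              (λ j j≢i c eq → ⊥-elim (j≢i (sym (cong proj₁ (pending R j c eq))))))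
            mono local
          where
          agrees′ : ∀ j → updateAt (knowledge R) i (const (just (h i))) j ≡
                          known (updateAt st i f j) (h j)
          agrees′ j with j ≟ i
          ... | yes refl = trans (updateAt-updates j (knowledge R))
                (trans (sym learnt) (cong (λ s → known s (h j)) (sym (updateAt-updates j st))))
          ... | no j≢i   = trans (updateAt-minimal j i (knowledge R) j≢i)
                (trans (agrees R j)
                       (cong (λ s → known s (h j)) (sym (updateAt-minimal j i st j≢i))))

      leave-end : Successor R p (cross (end i b , p))
      leave-end with h i ≟ p
      ... | yes refl = leave-by plain pass
              (trans (cong (λ K → guess K (h i) plain) (agrees R i)) (guess-hit (st i) (h i)))
              (crossEnd-hit (h i) i b)
              (pass-known (st i) b (h i) (visited R))
              (subst (λ s → Visited s (opposite b)) (sym (updateAt-updates i st))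
                 (pass-visited (st i) b (opposite b) (visited R)))
              (pass-pending (st i))
              (λ c _ → pass-visited (st i) b c (visited R))
              (subst (λ s → weight (pass (st i)) + 0 + slack s ≤ weight (st i) + slack (st i) + 1)
                 (sym (updateAt-updates i st)) (pass-cost (st i) b (visited R)))
      ... | no h≢p = leave-by (missHint (st i) (h i)) miss
              (trans (cong (λ K → guess K p (missHint (st i) (h i))) (agrees R i))
                     (guess-miss (st i) b (h i) p (visited R)))
              (crossEnd-miss i b h≢p)
              (miss-known (st i) b (h i) (visited R))
              tt
              (miss-pending (st i))
              (miss-mono (st i))
              (miss-cost (st i) b (h i) (visited R))

    successor-replay : ∀ {t v g p} (R : Replay t v g) → A advice g ≡ take p →
                       Successor R p (cross (v , p))
    successor-replay {v = sink j}  R act = leave-sink R act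
    successor-replay {v = end i b} R act = leave-end R act

    open Execution A advice graph (label (sink zero)) hiding (ExploresInTime)

    -- `VisitsWithin` brings its own derivation of `Reaches`; a visit at the present time must be
    -- identified with the present node of the run.
    Reaches-deterministic : ∀ {t u u′ g g′} → Reaches t u g → Reaches t u′ g′ →
                            _≡_ {A = Σ _ (History ∘ Graph.deg graph)} (u , g) (u′ , g′)
    Reaches-deterministic here here = refl
    Reaches-deterministic (move r a) (move r′ a′) with refl ← Reaches-deterministic r r′
      with refl ← trans (sym a) a′ = refl

    -- Indexed by the pair of node and history, so that `subst` can move it along `extend-push`.
    record Complete (t : ℕ) (position : Position) : Set where
      field
        replay    : Replay t (proj₁ position) (proj₂ position)
        complete  : ∀ {w} → VisitsWithin t w → VisitedNode (status replay) (node w)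

    replay-run : ∀ {t u g} → Reaches t u g → Complete t (node u , g)
    replay-run here = subst (Complete 0)
      (cong (λ v → v , start (degree v)) (sym (node-label (sink zero)))) record
      { replay   = initial
      ; complete = λ { (_ , z≤n , _ , here) → tt }
      }
    replay-run {suc t} run@(move {u = u} {h = g} {p = p} r a) =
      subst (Complete (suc t)) (sym (extend-push g p (cross (node u , p)))) record
        { replay   = proj₁ next
        ; complete = complete′
        }
      where
      open Complete (replay-run r)
      next = successor-replay replay a
      complete′ : ∀ {w} → VisitsWithin (suc t) w → VisitedNode (status (proj₁ next)) (node w)
      complete′ {w} (s , s≤t+1 , g′ , r′) with m≤n⇒m<n∨m≡n s≤t+1
      ... | inj₁ (s≤s s≤t) = proj₂ next (node w) (complete {w} (s , s≤t , g′ , r′))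
      ... | inj₂ refl with refl ← Reaches-deterministic run r′ =
            subst (VisitedNode (status (proj₁ next)))
              (sym (node-label (proj₁ (cross (node u , p)))))
              (visited (proj₁ next))

    -- Once all ends are visited, every gadget has weight 3 and a known port. The total weight in
    -- `cost` is then `k * 3`, and the final slack is dropped.
    explored : ∀ {t} → ExploresInTime A advice graph (label (sink zero)) t →
               ∃[ ss ] length ss ≡ t × k * 3 + corrections ss ≤ suc t × decode ss ≗ h
    explored {t} ((u , g , r , _) , all-visited) = hints replay , duration replay , bound , decoded
      where
      open Complete (replay-run r)
      end-visited : ∀ i b → Visited (status replay i) b
      end-visited i b = subst (VisitedNode (status replay)) (node-label (end i b))
                          (complete {label (end i b)} (all-visited (label (end i b))))
      settled : ∀ i → (∀ {D} (d : Fin D) → known (status replay i) d ≡ just d) ×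
                      weight (status replay i) ≡ 3
      settled i = both-visited (status replay i) (end-visited i zero) (end-visited i (suc zero))
      decoded : decode (hints replay) ≗ h
      decoded i = cong (fromMaybe zero)
        (trans (cong (λ x → proj₂ x i) (simulated replay))
               (trans (agrees replay i) (proj₁ (settled i) (h i))))
      bound : k * 3 + corrections (hints replay) ≤ suc t
      bound = begin
        k * 3 + corrections (hints replay)
          ≡⟨ cong (_+ corrections (hints replay))
               (trans (sum-cong-≗ (proj₂ ∘ settled)) (sum-const k 3)) ⟨
        sum (weight ∘ status replay) + corrections (hints replay)
          ≤⟨ m≤m+n _ _ ⟩
        sum (weight ∘ status replay) + corrections (hints replay) + slackAt (status replay) (node u)
          ≤⟨ cost replay ⟩
        suc t ∎
        where open ≤-Reasoning

-- Counting codes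

-- Otherwise the positions of the elements would embed `Fin N` into the indices of a shorter list.
∃∉ : ∀ {N} (xs : List (Fin N)) → length xs < N → ∃[ y ] y ∉ xs
∃∉ {N} xs short = ¬∀⟶∃¬ N (_∈ xs) (_∈? xs) not-all
  where
  open DecMembership (_≟_ {N}) using (_∈?_)
  not-all : (∀ y → y ∈ xs) → _
  not-all all = <⇒≱ short (injective⇒≤ {f = index ∘ all} λ {x} {y} eq →
    trans (lookup-index (all x)) (trans (cong (lookup xs) eq) (sym (lookup-index (all y)))))

length-cartesianProductWith : ∀ {A B C : Set} (f : A → B → C) xs ys →
  length (cartesianProductWith f xs ys) ≡ length xs * length ys
length-cartesianProductWith f []       ys = refl
length-cartesianProductWith f (x ∷ xs) ys =
  trans (length-++ (map (f x) ys))
        (cong₂ _+_ (length-map (f x) ys) (length-cartesianProductWith f xs ys))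

length-map-++-map : ∀ {A B : Set} (f g : A → B) xs →
                    length (map f xs ++ map g xs) ≡ 2 * length xs
length-map-++-map f g xs = begin
  length (map f xs ++ map g xs)           ≡⟨ length-++ (map f xs) ⟩
  length (map f xs) + length (map g xs)   ≡⟨ cong₂ _+_ (length-map f xs) (length-map g xs) ⟩
  length xs + length xs                   ≡⟨ cong (length xs +_) (+-identityʳ _) ⟨
  2 * length xs                           ∎
  where open ≡-Reasoning

adviceUpTo : ℕ → List Advice
adviceUpTo zero    = [] ∷ []
adviceUpTo (suc L) = [] ∷ map (true ∷_) (adviceUpTo L) ++ map (false ∷_) (adviceUpTo L)

∈-adviceUpTo : ∀ L a → length a ≤ L → a ∈ adviceUpTo L
∈-adviceUpTo zero    []          _       = here refl
∈-adviceUpTo (suc L) []          _       = here refl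
∈-adviceUpTo (suc L) (true ∷ a)  (s≤s l) = there (∈-++⁺ˡ (∈-map⁺ (true ∷_) (∈-adviceUpTo L a l)))
∈-adviceUpTo (suc L) (false ∷ a) (s≤s l) =
  there (∈-++⁺ʳ (map (true ∷_) (adviceUpTo L)) (∈-map⁺ (false ∷_) (∈-adviceUpTo L a l)))

length-adviceUpTo : ∀ L → length (adviceUpTo L) < 2 ^ suc L
length-adviceUpTo zero    = ≤-refl
length-adviceUpTo (suc L) = begin
  2 + length (map (true ∷_) (adviceUpTo L) ++ map (false ∷_) (adviceUpTo L))
    ≡⟨ cong (2 +_) (length-map-++-map (true ∷_) (false ∷_) (adviceUpTo L)) ⟩
  2 + 2 * length (adviceUpTo L)    ≡⟨ *-suc 2 (length (adviceUpTo L)) ⟨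
  2 * suc (length (adviceUpTo L))  ≤⟨ *-monoʳ-≤ 2 (length-adviceUpTo L) ⟩
  2 ^ suc (suc L)                  ∎
  where open ≤-Reasoning

module _ {D : ℕ} where

  hintsUpTo : ℕ → ℕ → List (List (Hint D))
  corrected : ℕ → ℕ → List (List (Hint D))

  hintsUpTo zero    W = [] ∷ []
  hintsUpTo (suc T) W =
    [] ∷ (map (plain ∷_) (hintsUpTo T W) ++ map (shifted ∷_) (hintsUpTo T W)) ++ corrected T W

  corrected T zero    = []
  corrected T (suc W) = cartesianProductWith (λ d → correction d ∷_) (allFin D) (hintsUpTo T W)

  ∈-hintsUpTo : ∀ T W ss → length ss ≤ T → corrections ss ≤ W → ss ∈ hintsUpTo T W
  ∈-hintsUpTo zero    W []               _       _ = here refl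
  ∈-hintsUpTo (suc T) W []               _       _ = here refl
  ∈-hintsUpTo (suc T) W (plain ∷ ss)     (s≤s l) c =
    there (∈-++⁺ˡ (∈-++⁺ˡ (∈-map⁺ (plain ∷_) (∈-hintsUpTo T W ss l c))))
  ∈-hintsUpTo (suc T) W (shifted ∷ ss)   (s≤s l) c =
    there (∈-++⁺ˡ (∈-++⁺ʳ (map (plain ∷_) (hintsUpTo T W))
      (∈-map⁺ (shifted ∷_) (∈-hintsUpTo T W ss l c))))
  ∈-hintsUpTo (suc T) (suc W) (correction d ∷ ss) (s≤s l) (s≤s c) =
    there (∈-++⁺ʳ (map (plain ∷_) (hintsUpTo T (suc W)) ++ map (shifted ∷_) (hintsUpTo T (suc W)))
      (∈-cartesianProductWith⁺ (λ d → correction d ∷_) (∈-allFin d) (∈-hintsUpTo T W ss l c)))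

  module _ .{{_ : NonZero D}} where

    -- Each unit of length contributes a factor 4: one share for ending the list, two for `plain`
    -- and `shifted`, one for a correction, whose `D` values are charged to `D ^ W`.
    length-hintsUpTo : ∀ T W → length (hintsUpTo T W) ≤ 4 ^ T * D ^ W
    length-corrected : ∀ T W → length (corrected T W) ≤ 4 ^ T * D ^ W

    length-hintsUpTo zero    W = ≤-trans (m^n>0 D W) (≤-reflexive (sym (*-identityˡ (D ^ W))))
    length-hintsUpTo (suc T) W = begin
      suc (length (doubled ++ corrected T W))         ≡⟨ cong suc (length-++ doubled) ⟩
      suc (length doubled + length (corrected T W))
        ≡⟨ cong (λ n → suc (n + length (corrected T W)))
             (length-map-++-map (plain ∷_) (shifted ∷_) (hintsUpTo T W)) ⟩
      1 + (2 * length (hintsUpTo T W) + length (corrected T W))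
        ≤⟨ +-mono-≤ (*-mono-≤ (m^n>0 4 T) (m^n>0 D W))
             (+-mono-≤ (*-monoʳ-≤ 2 (length-hintsUpTo T W)) (length-corrected T W)) ⟩
      4 ^ T * D ^ W + (2 * (4 ^ T * D ^ W) + 4 ^ T * D ^ W)  ≡⟨ four (4 ^ T) (D ^ W) ⟩
      4 ^ suc T * D ^ W ∎
      where
      open ≤-Reasoning
      doubled = map (plain ∷_) (hintsUpTo T W) ++ map (shifted ∷_) (hintsUpTo T W)
      four : ∀ x y → x * y + (2 * (x * y) + x * y) ≡ 4 * x * y
      four = solve-∀

    length-corrected T zero    = z≤n
    length-corrected T (suc W) = begin
      length (corrected T (suc W))
        ≡⟨ length-cartesianProductWith (λ d → correction d ∷_) (allFin D) (hintsUpTo T W) ⟩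
      length (allFin D) * length (hintsUpTo T W)
        ≡⟨ cong (_* length (hintsUpTo T W)) (length-tabulate {n = D} id) ⟩
      D * length (hintsUpTo T W)                  ≤⟨ *-monoʳ-≤ D (length-hintsUpTo T W) ⟩
      D * (4 ^ T * D ^ W)                         ≡⟨ swap D (4 ^ T) (D ^ W) ⟩
      4 ^ T * D ^ suc W                           ∎
      where
      open ≤-Reasoning
      swap : ∀ x y z → x * (y * z) ≡ y * (x * z)
      swap = solve-∀

-- Decoding recovers `h` only pointwise; this carries the agreement over to codes without function
-- extensionality.
funToFin-cong : ∀ {m n} {f g : Fin m → Fin n} → f ≗ g → funToFin f ≡ funToFin g
funToFin-cong {zero}  eq = refl
funToFin-cong {suc m} eq = cong₂ combine (eq zero) (funToFin-cong (eq ∘ suc))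

-- A choice of hidden ports that is never decoded

module _ (A : Algorithm) (k′ L W : ℕ) where

  open GadgetGraph k′

  -- The choice `h` escapes the decodings under all short advice strings at once. Hence the advice
  -- may afterwards depend on `h`, as that of an oracle does.
  undecoded : length (adviceUpTo L) * length (hintsUpTo {D} (k * 3 + W) W) < D ^ k →
    ∃[ h ] ∀ a → length a ≤ L → ∀ t →
      ExploresInTime A a (Hidden.graph h) (label (sink zero)) t → k * 3 + W ≤ t
  undecoded few = finToFun y , slow
    where
    decodeAs : Advice → List (Hint D) → Fin (D ^ k)
    decodeAs a ss = funToFin (Simulation.decode A a k′ ss)

    decodable : List (Fin (D ^ k))
    decodable = cartesianProductWith decodeAs (adviceUpTo L) (hintsUpTo (k * 3 + W) W)

    hard : ∃[ y ] y ∉ decodable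
    hard = ∃∉ decodable (subst (_< D ^ k)
      (sym (length-cartesianProductWith decodeAs (adviceUpTo L) (hintsUpTo (k * 3 + W) W))) few)

    y = proj₁ hard

    slow : ∀ a → length a ≤ L → ∀ t →
           ExploresInTime A a (Hidden.graph (finToFun y)) (label (sink zero)) t → k * 3 + W ≤ t
    slow a a≤L t explores = ≮⇒≥ λ fast →
      let ss , duration , bound , decoded = Simulation.Correct.explored A a k′ (finToFun y) explores
          ss∈hints = ∈-hintsUpTo (k * 3 + W) W ss (≤-trans (≤-reflexive duration) (<⇒≤ fast))
                       -- A fast run has `suc t ≤ k * 3 + W`, which matches the `suc t` in `bound`
                       -- and leaves at most `W` corrections.
                       (+-cancelˡ-≤ (k * 3) _ _ (≤-trans bound fast))
          decoded-y = trans (funToFin-cong decoded) (funToFin-finToFin {k} {D} y)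
      in proj₂ hard (subst (_∈ decodable) decoded-y
           (∈-cartesianProductWith⁺ decodeAs (∈-adviceUpTo L a a≤L) ss∈hints))

-- Arithmetic

^-cancelˡ-≤ : ∀ {m n} p .{{_ : NonZero p}} → m ^ p ≤ n ^ p → m ≤ n
^-cancelˡ-≤ p mᵖ≤nᵖ = ≮⇒≥ λ n<m → <⇒≱ (^-monoˡ-< p n<m) mᵖ≤nᵖ

^-distribʳ-* : ∀ p m n → (m * n) ^ p ≡ m ^ p * n ^ p
^-distribʳ-* zero    m n = refl
^-distribʳ-* (suc p) m n =
  trans (cong (m * n *_) (^-distribʳ-* p m n)) (interchange m n (m ^ p) (n ^ p))
  where
  interchange : ∀ a b c d → a * b * (c * d) ≡ a * c * (b * d)
  interchange = solve-∀

^-swap : ∀ m p q → (m ^ p) ^ q ≡ (m ^ q) ^ p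
^-swap m p q = trans (^-*-assoc m p q) (trans (cong (m ^_) (*-comm p q)) (sym (^-*-assoc m q p)))

∃log₂ : ∀ x → 0 < x → ∃[ L ] 2 ^ L ≤ x × x < 2 ^ suc L
∃log₂ (suc zero)    _ = 0 , ≤-refl , ≤-refl
∃log₂ (suc (suc x)) _ with ∃log₂ (suc x) z<s
... | L , low , high with suc (suc x) <? 2 ^ suc L
...   | yes high′ = L , m≤n⇒m≤1+n low , high′
...   | no ¬high  = suc L , ≮⇒≥ ¬high ,
        <-≤-trans (s<s high) (≤-trans (+-monoˡ-≤ (2 ^ suc L) (m^n>0 2 (suc L)))
          (≤-reflexive (cong (2 ^ suc L +_) (sym (+-identityʳ (2 ^ suc L))))))

-- With D > w ≥ 4 ^ 7, the factors 2 ^ (1 + L), 4 ^ (3 k + w) and D ^ w of the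
-- number of codes are at most D ^ (3 w), D ^ (7 w) and D ^ w, while k = 16 w.
few-codes : ∀ w L → let k = 16 * w; D = suc k in 4 ^ 7 ≤ w → 2 ^ L ≤ (k * 3) ^ w →
            length (adviceUpTo L) * length (hintsUpTo {D} (k * 3 + w) w) < D ^ k
few-codes w L large small = begin-strict
  length (adviceUpTo L) * length (hintsUpTo {D} (k * 3 + w) w)
    ≤⟨ *-monoʳ-≤ (length (adviceUpTo L)) (length-hintsUpTo (k * 3 + w) w) ⟩
  length (adviceUpTo L) * (4 ^ (k * 3 + w) * D ^ w)
    <⟨ *-monoˡ-< (4 ^ (k * 3 + w) * D ^ w) {{m*n≢0 _ _ {{m^n≢0 4 (k * 3 + w)}} {{m^n≢0 D w}}}}
         (length-adviceUpTo L) ⟩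
  2 * 2 ^ L * (4 ^ (k * 3 + w) * D ^ w)
    ≤⟨ *-mono-≤ (*-mono-≤ 2≤Dʷ advice≤) (*-monoˡ-≤ (D ^ w) hints≤) ⟩
  D ^ w * D ^ (2 * w) * (D ^ (7 * w) * D ^ w)
    ≡⟨ cong₂ _*_ (^-distribˡ-+-* D w (2 * w)) (^-distribˡ-+-* D (7 * w) w) ⟨
  D ^ (w + 2 * w) * D ^ (7 * w + w)
    ≡⟨ ^-distribˡ-+-* D (w + 2 * w) (7 * w + w) ⟨
  D ^ (w + 2 * w + (7 * w + w))
    ≤⟨ ^-monoʳ-≤ D (≤-trans (m≤m+n (w + 2 * w + (7 * w + w)) (5 * w)) (≤-reflexive (exponents w))) ⟩
  D ^ k ∎
  where
  open ≤-Reasoning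
  k = 16 * w
  D = suc k
  exponents : ∀ w → w + 2 * w + (7 * w + w) + 5 * w ≡ 16 * w
  exponents = solve-∀
  -- The exponent is `49 * w`; splitting it as 7 times `7 * w` isolates the base `4 ^ 7`, which is
  -- at most `D`.
  exponents₄ : ∀ w → 16 * w * 3 + w ≡ 7 * (7 * w)
  exponents₄ = solve-∀
  1≤w : 1 ≤ w
  1≤w = ≤-trans (m^n>0 4 7) large
  w≤D : w ≤ D
  w≤D = m≤n⇒m≤1+n (m≤m+n w (15 * w))
  3≤D : 3 ≤ D
  3≤D = ≤-trans (m≤m+n 3 13) (m≤n⇒m≤1+n (*-monoʳ-≤ 16 1≤w))
  2≤Dʷ : 2 ≤ D ^ w
  2≤Dʷ = ≤-trans (≤-trans (n≤1+n 2) 3≤D)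
    (≤-trans (≤-reflexive (sym (^-identityʳ D))) (^-monoʳ-≤ D 1≤w))
  hints≤ : 4 ^ (k * 3 + w) ≤ D ^ (7 * w)
  hints≤ = begin
    4 ^ (k * 3 + w)      ≡⟨ cong (4 ^_) (exponents₄ w) ⟩
    4 ^ (7 * (7 * w))    ≡⟨ ^-*-assoc 4 7 (7 * w) ⟨
    (4 ^ 7) ^ (7 * w)    ≤⟨ ^-monoˡ-≤ (7 * w) (≤-trans large w≤D) ⟩
    D ^ (7 * w)          ∎
  advice≤ : 2 ^ L ≤ D ^ (2 * w)
  advice≤ = begin
    2 ^ L            ≤⟨ small ⟩
    (k * 3) ^ w
      ≤⟨ ^-monoˡ-≤ w (*-mono-≤ (n≤1+n k) (≤-trans 3≤D (≤-reflexive (sym (*-identityʳ D))))) ⟩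
    (D ^ 2) ^ w      ≡⟨ ^-*-assoc D 2 w ⟩
    D ^ (2 * w)      ∎

-- Real exponents and extraction of roots

lower<upper : ∀ x {q r} → ℝ.lower x r → ℝ.upper x q → r ℚ.< q
lower<upper x {q} {r} low up with ℚ.<-cmp r q
... | tri< r<q _ _ = r<q
... | tri≈ _ refl _ = contradiction (low , up) (ℝ.disjoint x q)
... | tri> _ _ q<r = contradiction (low , Equivalence.from (ℝ.upper-rounded x r) (q , q<r , up))
                                   (ℝ.disjoint x r)

-- A rational below 1 with denominator `suc c` is at most `c / suc c`. The conclusion is the
-- resulting bound on `r`, cross-multiplied.
numerator-bound : ∀ {a c} r {q} → ℚ.↥ r ≡ ℤ.+ a → r ℚ.< q → q ℚ.< 1ℚ → ↧ₙ q ≡ suc c →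
                  a * suc c ≤ c * ↧ₙ r
numerator-bound {a} {c} (mkℚ _ d _) {mkℚ num _ _} refl (ℚ.*<* r<q) (ℚ.*<* q<1) refl =
  ℤ.drop‿+≤+ (begin
    ℤ.+ (a * suc c)             ≡⟨ ℤ.pos-* a (suc c) ⟩
    (ℤ.+ a) ℤ.* (ℤ.+ suc c)     ≤⟨ ℤ.<⇒≤ r<q ⟩
    num ℤ.* (ℤ.+ suc d)         ≤⟨ ℤ.*-monoʳ-≤-nonNeg (ℤ.+ suc d) num≤c ⟩
    (ℤ.+ c) ℤ.* (ℤ.+ suc d)     ≡⟨ ℤ.pos-* c (suc d) ⟨
    ℤ.+ (c * suc d)             ∎)
  where
  open ℤ.≤-Reasoning
  num≤c : num ℤ.≤ (ℤ.+ c)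
  num≤c = ℤ.i<j⇒i≤pred[j] (subst₂ ℤ._<_ (ℤ.*-identityʳ num) (ℤ.*-identityˡ (ℤ.+ suc c)) q<1)

-- The single exponent `c / suc c` dominates every rational below `q`. Raising both sides to the
-- power `suc c` makes the comparison one of integer powers; a negative exponent only needs positive
-- factors.
powerℚAtMost : ∀ {c q} n m .{{_ : NonZero n}} .{{_ : NonZero m}} → n ^ c ≤ m ^ suc c →
               q ℚ.< 1ℚ → ↧ₙ q ≡ suc c → ∀ r → r ℚ.< q → PowerℚAtMost n r m
powerℚAtMost {c} n m roots q<1 denom r@(mkℚ (ℤ.+ a) d _) r<q = ^-cancelˡ-≤ (suc c) (begin
  (n ^ a) ^ suc c          ≡⟨ ^-*-assoc n a (suc c) ⟩
  n ^ (a * suc c)          ≤⟨ ^-monoʳ-≤ n (numerator-bound r refl r<q q<1 denom) ⟩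
  n ^ (c * suc d)          ≡⟨ ^-*-assoc n c (suc d) ⟨
  (n ^ c) ^ suc d          ≤⟨ ^-monoˡ-≤ (suc d) roots ⟩
  (m ^ suc c) ^ suc d      ≡⟨ ^-swap m (suc c) (suc d) ⟩
  (m ^ suc d) ^ suc c      ∎)
  where open ≤-Reasoning
powerℚAtMost n m roots q<1 denom (mkℚ ℤ.-[1+ a ] d _) r<q =
  *-mono-≤ (m^n>0 m (suc d)) (m^n>0 n (suc a))

-- Used with `p = 48`: since `w = n / 48`, the little-o bound with constant 1/48 becomes a bound of
-- `w` times the logarithm of `n`.
take-root : ∀ {n p} .{{_ : NonZero p}} w s → n ≡ w * p → 2 ^ (p * s) ≤ n ^ n → 2 ^ s ≤ n ^ w
take-root {n} {p} w s n≡wp bound = ^-cancelˡ-≤ p (begin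
  (2 ^ s) ^ p   ≡⟨ ^-*-assoc 2 s p ⟩
  2 ^ (s * p)   ≡⟨ cong (2 ^_) (*-comm s p) ⟩
  2 ^ (p * s)   ≤⟨ bound ⟩
  n ^ n         ≡⟨ cong (n ^_) n≡wp ⟩
  n ^ (w * p)   ≡⟨ ^-*-assoc n w p ⟨
  (n ^ w) ^ p   ∎)
  where open ≤-Reasoning

-- The excess `w` is only a fraction `1 / p` of `n`; the lost factor `p ^ c` is covered by one extra
-- factor `w`.
absorb-factor : ∀ {n w} p c → n ≡ p * w → p ^ c ≤ w → n ^ c ≤ w ^ suc c
absorb-factor {n} {w} p c n≡pw pᶜ≤w = begin
  n ^ c           ≡⟨ cong (_^ c) n≡pw ⟩
  (p * w) ^ c     ≡⟨ ^-distribʳ-* c p w ⟩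
  p ^ c * w ^ c   ≤⟨ *-monoˡ-≤ (w ^ c) pᶜ≤w ⟩
  w ^ suc c       ∎
  where open ≤-Reasoning

-- The hard instance and the choice of its size

hard-instance : ∀ u c (f : InstanceOracle) (A : Algorithm) → let w = suc u; n = 16 * w * 3 in
  4 ^ 7 ≤ w → 48 ^ c ≤ w →
  (∀ (G : Graph n) v → AtMost-nlog₂n n (48 * length (f G v))) →
  Σ[ G ∈ Graph n ] Hamiltonian G × Σ[ v ∈ Fin n ]
    (∀ t → ExploresInTime A (f G v) G v t → n ≤ t × n ^ c ≤ (t ∸ n) ^ suc c × 1 ≤ t ∸ n)
hard-instance u c f A 4^7≤w 48^c≤w small = graph , hamiltonian , start-node , slow
  where
  w = suc u
  n = 16 * w * 3

  -- `L` is the integer part of `w` times the logarithm of `n`, an upper bound for the advice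
  -- length.
  log = ∃log₂ (n ^ w) (m^n>0 n w)
  L = proj₁ log

  advice-length : ∀ (G : Graph n) v → length (f G v) ≤ L
  advice-length G v = ≮⇒≥ λ L<len → <⇒≱ (proj₂ (proj₂ log))
    (≤-trans (^-monoʳ-≤ 2 L<len) (take-root w (length (f G v)) (n≡w*48 w) (small G v)))
    where
    n≡w*48 : ∀ w → 16 * w * 3 ≡ w * 48
    n≡w*48 = solve-∀

  -- As `w = suc u`, the number `16 * w` reduces to `suc (u + 15 * w)`, the required form of `k`.
  hard = undecoded A (u + 15 * w) L w (few-codes w L 4^7≤w (proj₁ (proj₂ log)))
  open GadgetGraph (u + 15 * w) using (label; module Hidden)
  open Hidden (proj₁ hard) using (graph; hamiltonian)
  start-node = label (sink zero)

  n^c≤w^1+c : n ^ c ≤ w ^ suc c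
  n^c≤w^1+c = absorb-factor 48 c (n≡48*w w) 48^c≤w
    where
    n≡48*w : ∀ w → 16 * w * 3 ≡ 48 * w
    n≡48*w = solve-∀

  slow : ∀ t → ExploresInTime A (f graph start-node) graph start-node t →
         n ≤ t × n ^ c ≤ (t ∸ n) ^ suc c × 1 ≤ t ∸ n
  slow t explores = ≤-trans (m≤m+n n w) n+w≤t ,
    ≤-trans n^c≤w^1+c (^-monoˡ-≤ (suc c) w≤t∸n) , ≤-trans (s≤s z≤n) w≤t∸n
    where
    n+w≤t : n + w ≤ t
    n+w≤t = proj₂ hard (f graph start-node) (advice-length graph start-node) t explores
    w≤t∸n : w ≤ t ∸ n
    w≤t∸n = ≤-trans (≤-reflexive (sym (m+n∸m≡n n w))) (∸-monoˡ-≤ n n+w≤t)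

mainTheorem13 : (ε : ℝ) → ε <1 →
    (f : InstanceOracle) → AdviceSize-o[nlogn] f →
    (A : Algorithm) →
    ∀ N → ∃[ n ] N ≤ n ×
    (Σ[ G ∈ Graph n ] Hamiltonian G ×
    (Σ[ v ∈ Fin n ]
    (∀ t → ExploresInTime A (f G v) G v t → AtLeast-n+n^ε n ε t)))
mainTheorem13 ε ε<1 f small A N =
  instance-above (N ⊔ N₀ ⊔ (48 ^ c ⊔ 4 ^ 7))
    (≤-trans (m≤m⊔n N N₀) (m≤m⊔n (N ⊔ N₀) _))
    (≤-trans (m≤n⊔m N N₀) (m≤m⊔n (N ⊔ N₀) _))
    (≤-trans (m≤m⊔n (48 ^ c) (4 ^ 7)) (m≤n⊔m (N ⊔ N₀) _))
    (≤-trans (m≤n⊔m (48 ^ c) (4 ^ 7)) (m≤n⊔m (N ⊔ N₀) _))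
  where
  -- Roundedness of the upper cut gives a rational `q` with ε < `q` < 1. With `c` its denominator
  -- minus one, `q` is at most `c / suc c`.
  rational-above = Equivalence.to (ℝ.upper-rounded ε 1ℚ) ε<1
  q = proj₁ rational-above
  c = ℚ.denominator-1 q
  N₀ = proj₁ (small 48)

  instance-above : ∀ u → N ≤ u → N₀ ≤ u → 48 ^ c ≤ u → 4 ^ 7 ≤ u →
    ∃[ n ] N ≤ n × (Σ[ G ∈ Graph n ] Hamiltonian G × (Σ[ v ∈ Fin n ]
      (∀ t → ExploresInTime A (f G v) G v t → AtLeast-n+n^ε n ε t)))
  instance-above u N≤u N₀≤u 48^c≤u 4^7≤u =
    let G , hamiltonian , v , slow = hard-instance u c f A (m≤n⇒m≤1+n 4^7≤u) (m≤n⇒m≤1+n 48^c≤u)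
                                       (proj₂ (small 48) n (≤-trans N₀≤u u≤n))
    in n , ≤-trans N≤u u≤n , G , hamiltonian , v , λ t explores →
       let n≤t , n^c≤ , 1≤t∸n = slow t explores
       in n≤t , λ r r<ε → powerℚAtMost n (t ∸ n) {{_}} {{>-nonZero 1≤t∸n}} n^c≤
            (proj₁ (proj₂ rational-above)) refl r (lower<upper ε r<ε (proj₂ (proj₂ rational-above)))
    where
    n = 16 * suc u * 3
    u≤n : u ≤ n
    u≤n = ≤-trans (n≤1+n u) (≤-trans (m≤m+n (suc u) (15 * suc u)) (m≤m*n (16 * suc u) 3))
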